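{- Let $G=(V,E,w)$ be a finite connected graph with $|V|=n\ge2$ and weights $w:E\to\mathbb{R}_{>0}$. Define $$\Gamma(G)=\max_{\substack{S\subseteq V,\ |S|\ge2\\ G[S]\text{ connected}}}\frac{|S|-1}{\operatorname{diam}_{d_G}(S)}.$$ Then $$\operatorname{OPT}_{\mathrm{card}}(G,w)\le\Gamma(G)\,\operatorname{OPT}_{\mathrm{free}}(G,w).$$
   Context: $d_G$ is the shortest-path metric of $(V,E)$ with every edge of length $1$ (weights are not lengths); $\operatorname{diam}_{d_G}(S)=\max_{a,b\in S}d_G(a,b)$. $\operatorname{OPT}_{\mathrm{free}}(G,w)$ is the minimum of $\sum_{xy\in E}w_{xy}u(x,y)$ over all ultrametrics $u$ on $V$ (metrics with $u(x,y)\le\max\{u(x,z),u(z,y)\}$) with $u\ge d_G$ on all pairs. A rooted binary hierarchy $H$ on $V$ is a rooted tree whose leaves are the vertices of $V$ and whose internal nodes have exactly two children; $C_H(x,y)$ is the set of leaves below the lowest common ancestor of $x,y$; $h_H(x,x)=0$ and $h_H(x,y)=|C_H(x,y)|-1$ for $x\ne y$. $\operatorname{OPT}_{\mathrm{card}}(G,w)$ is the minimum of $\sum_{xy\in E}w_{xy}h_H(x,y)$ over all rooted binary hierarchies $H$ on $V$ with $h_H\ge d_G$ on all pairs. -}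

module Defs where

open import Data.Bool using (if_then_else_)
open import Data.Empty using (⊥-elim)
open import Data.Fin as Fin using (Fin; zero; suc)
open import Data.Fin.Properties as Fin using (any?)
open import Data.Fin.Subset using (Subset; inside; outside; ∣_∣)
  renaming (_∈_ to _∈ₛ_)
open import Data.Fin.Subset.Properties using () renaming (_∈?_ to _∈ₛ?_)
open import Data.Integer using (+_)
open import Data.List
  using (List; length; map; filter; foldr; allFin; cartesianProduct)
open import Data.List.Extrema.Nat using (max; v≤max⁺)
open import Data.List.Membership.Propositional.Properties
  using (∈-allFin; ∈-cartesianProduct⁺; ∈-filter⁺; ∈-map⁺)
open import Data.List.Relation.Binary.Permutation.Propositional using (_↭_)
import Data.List.Membership.DecPropositional as DecMembership
open import Data.List.Relation.Unary.Any as Any using ()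
open import Data.Nat as ℕ using (ℕ; zero; suc; z≤n; s≤s)
import Data.Nat.Properties as ℕ
open import Data.Product using (Σ; ∃; _×_; _,_; proj₁; proj₂)
open import Data.Rational as ℚ using (ℚ; 0ℚ; 1ℚ; ½)
import Data.Rational.Properties as ℚ
open import Data.Rational.Solver using (module +-*-Solver)
open import Data.Sum using (inj₁; inj₂)
open import Data.Tree.Binary using (Tree; leaf; node; module Leaves)
open import Data.Unit using (⊤)
open import Data.Vec using ([]; _∷_; here; there)
open import Function using (_on_)
open import Function.Metric.Core using (DistanceFunction)
open import Function.Metric.Structures using (IsGeneralMetric)
open import Level using (0ℓ)
open import Relation.Binary using (Rel; Decidable; Symmetric; Irreflexive; IsPartialOrder)
open import Relation.Binary.PropositionalEquality
  using (_≡_; _≢_; refl; sym; trans; cong; subst; subst₂)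
open import Relation.Nullary using (Dec; yes; no; does; ¬_; map′; _×-dec_)
import Relation.Unary as U

-≤⇒≤+ : ∀ a b {e} → ℚ.∣ a ℚ.- b ∣ ℚ.≤ e → a ℚ.≤ b ℚ.+ e
-≤⇒≤+ a b {e} h =
  subst (ℚ._≤ b ℚ.+ e)
    (solve 2 (λ a b → b :+ (a :- b) := a) refl a b)
    (ℚ.+-monoʳ-≤ b (ℚ.≤-trans (p≤∣p∣ (a ℚ.- b)) h))
  where
  open +-*-Solver
  p≤∣p∣ : ∀ p → p ℚ.≤ ℚ.∣ p ∣
  p≤∣p∣ p with ℚ.≤-total 0ℚ p
  ... | inj₁ 0≤p = ℚ.≤-reflexive (sym (ℚ.0≤p⇒∣p∣≡p 0≤p))
  ... | inj₂ p≤0 = ℚ.≤-trans p≤0 (ℚ.0≤∣p∣ p)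

∣-∣-comm : ∀ a b → ℚ.∣ a ℚ.- b ∣ ≡ ℚ.∣ b ℚ.- a ∣
∣-∣-comm a b = trans (sym (ℚ.∣-p∣≡∣p∣ (a ℚ.- b)))
  (cong ℚ.∣_∣ (solve 2 (λ a b → :- (a :- b) := b :- a) refl a b))
  where open +-*-Solver

≤+⇒-≤ : ∀ {a b e} → a ℚ.≤ b ℚ.+ e → b ℚ.≤ a ℚ.+ e → ℚ.∣ a ℚ.- b ∣ ℚ.≤ e
≤+⇒-≤ {a} {b} {e} p q with ℚ.∣p∣≡p∨∣p∣≡-p (a ℚ.- b)
... | inj₁ eq = subst₂ ℚ._≤_ (sym eq)
      (solve 2 (λ b e → (b :+ e) :- b := e) refl b e)
      (ℚ.+-monoˡ-≤ (ℚ.- b) p)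
  where open +-*-Solver
... | inj₂ eq = subst₂ ℚ._≤_
      (trans (solve 2 (λ a b → b :- a := :- (a :- b)) refl a b) (sym eq))
      (solve 2 (λ a e → (a :+ e) :- a := e) refl a e)
      (ℚ.+-monoˡ-≤ (ℚ.- a) q)
  where open +-*-Solver

half+half : ∀ e → e ℚ.* ½ ℚ.+ e ℚ.* ½ ≡ e
half+half e = trans (sym (ℚ.*-distribˡ-+ e ½ ½)) (ℚ.*-identityʳ e)

0<* : ∀ {a b} → 0ℚ ℚ.< a → 0ℚ ℚ.< b → 0ℚ ℚ.< a ℚ.* b
0<* {a} {b} p q = ℚ.positive⁻¹ (a ℚ.* b)
  {{ℚ.pos*pos⇒pos a {{ℚ.positive p}} b {{ℚ.positive q}}}}

0<½ : 0ℚ ℚ.< ½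
0<½ = ℚ.positive⁻¹ ½

∣+∣-split : ∀ a b a′ b′ {e f} → ℚ.∣ a ℚ.- a′ ∣ ℚ.≤ e → ℚ.∣ b ℚ.- b′ ∣ ℚ.≤ f →
            ℚ.∣ (a ℚ.+ b) ℚ.- (a′ ℚ.+ b′) ∣ ℚ.≤ e ℚ.+ f
∣+∣-split a b a′ b′ p q = ℚ.≤-trans
  (subst (λ z → ℚ.∣ z ∣ ℚ.≤ ℚ.∣ a ℚ.- a′ ∣ ℚ.+ ℚ.∣ b ℚ.- b′ ∣)
    (solve 4 (λ a b a′ b′ → (a :- a′) :+ (b :- b′) := (a :+ b) :- (a′ :+ b′)) refl a b a′ b′)
    (ℚ.∣p+q∣≤∣p∣+∣q∣ (a ℚ.- a′) (b ℚ.- b′)))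
  (ℚ.+-mono-≤ p q)
  where open +-*-Solver

IsCauchy : (ℕ → ℚ) → Set
IsCauchy a = ∀ ε → 0ℚ ℚ.< ε →
  ∃ λ N → ∀ m n → N ℕ.≤ m → N ℕ.≤ n → ℚ.∣ a m ℚ.- a n ∣ ℚ.≤ ε

-- Real numbers are Cauchy sequences of rationals, identified up to _≈ℝ_.
record ℝ : Set where
  constructor mkℝ
  field
    seq    : ℕ → ℚ
    cauchy : IsCauchy seq

open ℝ public

infix  4 _≈ℝ_ _≤ℝ_ _<ℝ_
infixl 6 _+ℝ_ _⊔ℝ_
infixl 7 _*ℝ_

record _≈ℝ_ (x y : ℝ) : Set where
  constructor mk≈
  field
    close : ∀ ε → 0ℚ ℚ.< ε → ∃ λ N → ∀ n → N ℕ.≤ n → ℚ.∣ seq x n ℚ.- seq y n ∣ ℚ.≤ ε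

record _≤ℝ_ (x y : ℝ) : Set where
  constructor mk≤
  field
    below : ∀ ε → 0ℚ ℚ.< ε → ∃ λ N → ∀ n → N ℕ.≤ n → seq x n ℚ.≤ seq y n ℚ.+ ε

open _≈ℝ_ public
open _≤ℝ_ public

_<ℝ_ : Rel ℝ 0ℓ
x <ℝ y = ∃ λ ε → 0ℚ ℚ.< ε × ∃ λ N → ∀ n → N ℕ.≤ n → seq x n ℚ.+ ε ℚ.≤ seq y n

fromℚ : ℚ → ℝ
fromℚ q = mkℝ (λ _ → q) λ ε 0<ε → 0 , λ _ _ _ _ →
  ℚ.≤-trans (ℚ.≤-reflexive (cong ℚ.∣_∣ (ℚ.+-inverseʳ q))) (ℚ.<⇒≤ 0<ε)

fromℕ : ℕ → ℝ
fromℕ k = fromℚ (+ k ℚ./ 1)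

0ℝ : ℝ
0ℝ = fromℚ 0ℚ

abstract
  +-cauchy : ∀ x y → IsCauchy (λ n → seq x n ℚ.+ seq y n)
  +-cauchy x y = λ ε 0<ε →
    let (M , hx) = cauchy x (ε ℚ.* ½) (0<* 0<ε 0<½)
        (N , hy) = cauchy y (ε ℚ.* ½) (0<* 0<ε 0<½)
    in M ℕ.⊔ N , λ m n m≥ n≥ → subst (_ ℚ.≤_) (half+half ε)
         (∣+∣-split (seq x m) (seq y m) (seq x n) (seq y n)
           (hx m n (ℕ.m⊔n≤o⇒m≤o M N m≥) (ℕ.m⊔n≤o⇒m≤o M N n≥))
           (hy m n (ℕ.m⊔n≤o⇒n≤o M N m≥) (ℕ.m⊔n≤o⇒n≤o M N n≥)))

_+ℝ_ : ℝ → ℝ → ℝ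
x +ℝ y = mkℝ (λ n → seq x n ℚ.+ seq y n) (+-cauchy x y)

abstract
  ⊔-cauchy : ∀ x y → IsCauchy (λ n → seq x n ℚ.⊔ seq y n)
  ⊔-cauchy x y = λ ε 0<ε →
    let (M , hx) = cauchy x ε 0<ε
        (N , hy) = cauchy y ε 0<ε
        below : ∀ m n → M ℕ.⊔ N ℕ.≤ m → M ℕ.⊔ N ℕ.≤ n →
                seq x m ℚ.⊔ seq y m ℚ.≤ seq x n ℚ.⊔ seq y n ℚ.+ ε
        below m n m≥ n≥ = ℚ.⊔-lub
          (ℚ.≤-trans (-≤⇒≤+ (seq x m) (seq x n) (hx m n (ℕ.m⊔n≤o⇒m≤o M N m≥) (ℕ.m⊔n≤o⇒m≤o M N n≥)))
                     (ℚ.+-monoˡ-≤ ε (ℚ.p≤p⊔q (seq x n) (seq y n))))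
          (ℚ.≤-trans (-≤⇒≤+ (seq y m) (seq y n) (hy m n (ℕ.m⊔n≤o⇒n≤o M N m≥) (ℕ.m⊔n≤o⇒n≤o M N n≥)))
                     (ℚ.+-monoˡ-≤ ε (ℚ.p≤q⊔p (seq x n) (seq y n))))
    in M ℕ.⊔ N , λ m n m≥ n≥ → ≤+⇒-≤ (below m n m≥ n≥) (below n m n≥ m≥)

_⊔ℝ_ : ℝ → ℝ → ℝ
x ⊔ℝ y = mkℝ (λ n → seq x n ℚ.⊔ seq y n) (⊔-cauchy x y)

-- A Cauchy sequence is eventually bounded by some B > 0.
bounded : ∀ x → ∃ λ B → 0ℚ ℚ.< B × ∃ λ N → ∀ n → N ℕ.≤ n → ℚ.∣ seq x n ∣ ℚ.≤ B
bounded x =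
  let (N , h) = cauchy x 1ℚ (ℚ.positive⁻¹ 1ℚ)
      b = seq x N
  in ℚ.∣ b ∣ ℚ.+ 1ℚ
   , ℚ.+-mono-≤-< (ℚ.0≤∣p∣ b) (ℚ.positive⁻¹ 1ℚ)
   , N
   , λ n n≥ → ℚ.≤-trans
       (subst (λ z → ℚ.∣ z ∣ ℚ.≤ ℚ.∣ b ∣ ℚ.+ ℚ.∣ seq x n ℚ.- b ∣)
         (solve 2 (λ a b → b :+ (a :- b) := a) refl (seq x n) b)
         (ℚ.∣p+q∣≤∣p∣+∣q∣ b (seq x n ℚ.- b)))
       (ℚ.+-monoʳ-≤ ℚ.∣ b ∣ (h n N n≥ ℕ.≤-refl))
  where open +-*-Solver

-- For 0 < e and 0 < B there is δ > 0 with B * δ = e.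
quotient : ∀ {e B} → 0ℚ ℚ.< e → 0ℚ ℚ.< B → ∃ λ δ → 0ℚ ℚ.< δ × B ℚ.* δ ≡ e
quotient {e} {B} 0<e 0<B =
  B⁻¹ ℚ.* e
  , 0<* (ℚ.positive⁻¹ B⁻¹ {{ℚ.1/pos⇒pos B}}) 0<e
  , trans (sym (ℚ.*-assoc B B⁻¹ e))
      (trans (cong (ℚ._* e) (ℚ.*-inverseʳ B)) (ℚ.*-identityˡ e))
  where
  instance
    B-pos : ℚ.Positive B
    B-pos = ℚ.positive 0<B
    B-nonZero : ℚ.NonZero B
    B-nonZero = ℚ.pos⇒nonZero B
  B⁻¹ = ℚ.1/ B

∣*∣-mono : ∀ {a b B δ} → 0ℚ ℚ.≤ B → ℚ.∣ a ∣ ℚ.≤ B → ℚ.∣ b ∣ ℚ.≤ δ →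
           ℚ.∣ a ℚ.* b ∣ ℚ.≤ B ℚ.* δ
∣*∣-mono {a} {b} {B} {δ} 0≤B p q =
  subst (ℚ._≤ B ℚ.* δ) (sym (ℚ.∣p*q∣≡∣p∣*∣q∣ a b))
    (ℚ.≤-trans
      (ℚ.*-monoʳ-≤-nonNeg ℚ.∣ b ∣ {{ℚ.∣-∣-nonNeg b}} p)
      (ℚ.*-monoˡ-≤-nonNeg B {{ℚ.nonNegative 0≤B}} q))

abstract
  *-cauchy : ∀ x y → IsCauchy (λ n → seq x n ℚ.* seq y n)
  *-cauchy x y = λ ε 0<ε →
    let (A , 0<A , K , hA)  = bounded x
        (B , 0<B , L , hB)  = bounded y
        0<ε/2               = 0<* 0<ε 0<½
        (δ , 0<δ , Aδ≡ε/2)  = quotient 0<ε/2 0<A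
        (η , 0<η , Bη≡ε/2)  = quotient 0<ε/2 0<B
        (M , hx)            = cauchy x η 0<η
        (N , hy)            = cauchy y δ 0<δ
    in (K ℕ.⊔ L) ℕ.⊔ (M ℕ.⊔ N) , λ m n m≥ n≥ →
       let KL≤m = ℕ.m⊔n≤o⇒m≤o (K ℕ.⊔ L) (M ℕ.⊔ N) m≥
           KL≤n = ℕ.m⊔n≤o⇒m≤o (K ℕ.⊔ L) (M ℕ.⊔ N) n≥
           MN≤m = ℕ.m⊔n≤o⇒n≤o (K ℕ.⊔ L) (M ℕ.⊔ N) m≥
           MN≤n = ℕ.m⊔n≤o⇒n≤o (K ℕ.⊔ L) (M ℕ.⊔ N) n≥
           a = seq x m ; b = seq y m ; c = seq x n ; d = seq y n
           p : ℚ.∣ a ℚ.* (b ℚ.- d) ∣ ℚ.≤ ε ℚ.* ½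
           p = subst (_ ℚ.≤_) Aδ≡ε/2 (∣*∣-mono (ℚ.<⇒≤ 0<A)
                 (hA m (ℕ.m⊔n≤o⇒m≤o K L KL≤m))
                 (hy m n (ℕ.m⊔n≤o⇒n≤o M N MN≤m) (ℕ.m⊔n≤o⇒n≤o M N MN≤n)))
           q : ℚ.∣ d ℚ.* (a ℚ.- c) ∣ ℚ.≤ ε ℚ.* ½
           q = subst (_ ℚ.≤_) Bη≡ε/2 (∣*∣-mono (ℚ.<⇒≤ 0<B)
                 (hB n (ℕ.m⊔n≤o⇒n≤o K L KL≤n))
                 (hx m n (ℕ.m⊔n≤o⇒m≤o M N MN≤m) (ℕ.m⊔n≤o⇒m≤o M N MN≤n)))
       in subst₂ (λ z e → ℚ.∣ z ∣ ℚ.≤ e)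
            (solve 4 (λ a b c d → a :* (b :- d) :+ d :* (a :- c) := a :* b :- c :* d)
               refl a b c d)
            (half+half ε)
            (ℚ.≤-trans (ℚ.∣p+q∣≤∣p∣+∣q∣ (a ℚ.* (b ℚ.- d)) (d ℚ.* (a ℚ.- c)))
                       (ℚ.+-mono-≤ p q))
    where open +-*-Solver

_*ℝ_ : ℝ → ℝ → ℝ
x *ℝ y = mkℝ (λ n → seq x n ℚ.* seq y n) (*-cauchy x y)

≤ℝ-isPartialOrder : IsPartialOrder _≈ℝ_ _≤ℝ_
≤ℝ-isPartialOrder = record
  { isPreorder = record
    { isEquivalence = record
      { refl  = λ {x} → ≤-antisym (≤-refl x) (≤-refl x)
      ; sym   = λ x≈y → ≤-antisym (≥-reflexive x≈y) (≤-reflexive x≈y)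
      ; trans = λ x≈y y≈z → ≤-antisym
          (≤-trans (≤-reflexive x≈y) (≤-reflexive y≈z))
          (≤-trans (≥-reflexive y≈z) (≥-reflexive x≈y))
      }
    ; reflexive = ≤-reflexive
    ; trans     = ≤-trans
    }
  ; antisym = ≤-antisym
  }
  where
  ≤-refl : ∀ x → x ≤ℝ x
  ≤-refl x .below ε 0<ε = 0 , λ n _ →
    subst (ℚ._≤ seq x n ℚ.+ ε) (ℚ.+-identityʳ (seq x n))
      (ℚ.+-monoʳ-≤ (seq x n) (ℚ.<⇒≤ 0<ε))

  ≤-reflexive : ∀ {x y} → x ≈ℝ y → x ≤ℝ y
  ≤-reflexive {x} {y} x≈y .below ε 0<ε = let (N , h) = close x≈y ε 0<ε in
    N , λ n n≥ → -≤⇒≤+ (seq x n) (seq y n) (h n n≥)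

  ≥-reflexive : ∀ {x y} → x ≈ℝ y → y ≤ℝ x
  ≥-reflexive {x} {y} x≈y .below ε 0<ε = let (N , h) = close x≈y ε 0<ε in
    N , λ n n≥ → -≤⇒≤+ (seq y n) (seq x n)
      (subst (ℚ._≤ ε) (∣-∣-comm (seq x n) (seq y n)) (h n n≥))

  ≤-trans : ∀ {x y z} → x ≤ℝ y → y ≤ℝ z → x ≤ℝ z
  ≤-trans {x} {y} {z} x≤y y≤z .below ε 0<ε =
    let (M , p) = below x≤y (ε ℚ.* ½) (0<* 0<ε 0<½)
        (N , q) = below y≤z (ε ℚ.* ½) (0<* 0<ε 0<½)
    in M ℕ.⊔ N , λ n n≥ → ℚ.≤-trans (p n (ℕ.m⊔n≤o⇒m≤o M N n≥))
         (subst (seq y n ℚ.+ ε ℚ.* ½ ℚ.≤_)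
           (trans (ℚ.+-assoc (seq z n) (ε ℚ.* ½) (ε ℚ.* ½))
                  (cong (seq z n ℚ.+_) (half+half ε)))
           (ℚ.+-monoˡ-≤ (ε ℚ.* ½) (q n (ℕ.m⊔n≤o⇒n≤o M N n≥))))

  ≤-antisym : ∀ {x y} → x ≤ℝ y → y ≤ℝ x → x ≈ℝ y
  ≤-antisym x≤y y≤x .close ε 0<ε =
    let (M , p) = below x≤y ε 0<ε
        (N , q) = below y≤x ε 0<ε
    in M ℕ.⊔ N , λ n n≥ →
       ≤+⇒-≤ (p n (ℕ.m⊔n≤o⇒m≤o M N n≥)) (q n (ℕ.m⊔n≤o⇒n≤o M N n≥))

sumℝ : List ℝ → ℝ
sumℝ = foldr _+ℝ_ 0ℝ

-- Extrema are attained: neither is a mere infimum or supremum.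
module _ {A B : Set} (_≈_ _≤_ : Rel B 0ℓ) (f : A → B) where

  IsMinimum : B → Set
  IsMinimum m = (∃ λ a → f a ≈ m) × (∀ a → m ≤ f a)

  IsMaximum : B → Set
  IsMaximum m = (∃ λ a → f a ≈ m) × (∀ a → f a ≤ m)

data Walk {V : Set} (R : Rel V 0ℓ) : ℕ → V → V → Set where
  []  : ∀ {x} → Walk R 0 x x
  _∷_ : ∀ {k x y z} → R x y → Walk R k y z → Walk R (suc k) x z

IsConnected : {V : Set} → Rel V 0ℓ → Set
IsConnected R = ∀ x y → ∃ λ k → Walk R k x y

walk? : ∀ {n} {R : Rel (Fin n) 0ℓ} → Decidable R →
        ∀ k x y → Dec (Walk R k x y)
walk? R? zero x y = map′ (λ { refl → [] }) (λ { [] → refl }) (x Fin.≟ y)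
walk? R? (suc k) x z =
  map′ (λ { (_ , r , p) → r ∷ p }) (λ { (r ∷ p) → _ , r , p })
       (any? λ y → R? x y ×-dec walk? R? k y z)

least : {P : ℕ → Set} → U.Decidable P → ∃ P →
        ∃ λ k → P k × (∀ {j} → P j → k ℕ.≤ j)
least {P} P? (m , Pm) = go P? m Pm
  where
  go : ∀ {P : ℕ → Set} → U.Decidable P → ∀ m → P m →
       ∃ λ k → P k × (∀ {j} → P j → k ℕ.≤ j)
  go P? zero    Pm = 0 , Pm , λ _ → z≤n
  go {P} P? (suc m) Pm with P? 0
  ... | yes P0 = 0 , P0 , λ _ → z≤n
  ... | no ¬P0 = let (k , Pk , k≤) = go (λ j → P? (suc j)) m Pm in
    suc k , Pk , λ { {zero} P0 → ⊥-elim (¬P0 P0) ; {suc j} Pj → s≤s (k≤ Pj) }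

record ConnectedWeightedGraph (n : ℕ) : Set₁ where
  field
    Adj       : Rel (Fin n) 0ℓ
    adj?      : Decidable Adj
    adj-sym   : Symmetric Adj
    adj-irr   : Irreflexive _≡_ Adj
    connected : IsConnected Adj
    -- Values of w at non-adjacent pairs are unconstrained and never used.
    w         : Fin n → Fin n → ℝ
    w-sym     : ∀ {x y} → Adj x y → w x y ≈ℝ w y x
    w-pos     : ∀ {x y} → Adj x y → 0ℝ <ℝ w x y

-- The two children of a node are ordered in this representation, which is
-- harmless: no quantity below depends on the order.
record Hierarchy (n : ℕ) : Set where
  field
    tree   : Tree ⊤ (Fin n)
    leaves : Leaves.toList tree ↭ allFin n

module _ {n : ℕ} where
  open DecMembership (Fin._≟_ {n}) using (_∈?_)

  -- The subtree rooted at the lowest common ancestor of two leaves.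
  lca : Tree ⊤ (Fin n) → Fin n → Fin n → Tree ⊤ (Fin n)
  lca (leaf z)         x y = leaf z
  lca t@(node t₁ _ t₂) x y =
    if does (x ∈? Leaves.toList t₁ ×-dec y ∈? Leaves.toList t₁) then lca t₁ x y
    else if does (x ∈? Leaves.toList t₂ ×-dec y ∈? Leaves.toList t₂) then lca t₂ x y
    else t

  module _ (H : Hierarchy n) where
    open Hierarchy H

    -- A duplicate-free list, since the leaves of H are.
    C : Fin n → Fin n → List (Fin n)
    C x y = Leaves.toList (lca tree x y)

    h : Fin n → Fin n → ℕ
    h x y = if does (x Fin.≟ y) then 0 else length (C x y) ℕ.∸ 1

-- The strong triangle inequality u x z ≤ u x y ⊔ u y z implies the ordinary one.
IsUltrametric : {V : Set} → DistanceFunction V ℝ → Set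
IsUltrametric = IsGeneralMetric _≡_ _≈ℝ_ _≤ℝ_ 0ℝ _⊔ℝ_

two-elements : ∀ {n} (S : Subset n) → 2 ℕ.≤ ∣ S ∣ →
               ∃ λ x → ∃ λ y → x ∈ₛ S × y ∈ₛ S × x ≢ y
two-elements (outside ∷ S) 2≤ =
  let (x , y , x∈ , y∈ , x≢y) = two-elements S 2≤
  in suc x , suc y , there x∈ , there y∈ , λ eq → x≢y (Fin.suc-injective eq)
two-elements (inside ∷ S) (s≤s 1≤) =
  let (y , y∈) = one-element S 1≤
  in zero , suc y , here , there y∈ , λ ()
  where
  one-element : ∀ {n} (S : Subset n) → 1 ℕ.≤ ∣ S ∣ → ∃ λ x → x ∈ₛ S
  one-element (inside  ∷ S) _  = zero , here
  one-element (outside ∷ S) 1≤ = let (x , x∈) = one-element S 1≤ in suc x , there x∈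

module _ {n : ℕ} (G : ConnectedWeightedGraph n) where
  open ConnectedWeightedGraph G

  shortestWalk : ∀ x y →
    ∃ λ k → Walk Adj k x y × (∀ {j} → Walk Adj j x y → k ℕ.≤ j)
  shortestWalk x y = least (λ k → walk? adj? k x y) (connected x y)

  d : Fin n → Fin n → ℕ
  d x y = proj₁ (shortestWalk x y)

  pairs : List (Fin n × Fin n)
  pairs = cartesianProduct (allFin n) (allFin n)

  -- Each edge of G once, as the pair of its endpoints in increasing order.
  edges : List (Fin n × Fin n)
  edges = filter (λ (x , y) → x Fin.<? y ×-dec adj? x y) pairs

  cost : (Fin n → Fin n → ℝ) → ℝ
  cost u = sumℝ (map (λ (x , y) → w x y *ℝ u x y) edges)

  diam : Subset n → ℕ
  diam S = max 0 (map (λ (a , b) → d a b) (filter (λ (a , b) → a ∈ₛ? S ×-dec b ∈ₛ? S) pairs))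

  d≤diam : ∀ S {a b} → a ∈ₛ S → b ∈ₛ S → d a b ℕ.≤ diam S
  d≤diam S {a} {b} a∈ b∈ = v≤max⁺ 0 _ (inj₂ (Any.map ℕ.≤-reflexive
    (∈-map⁺ _ (∈-filter⁺ _ (∈-cartesianProduct⁺ (∈-allFin a) (∈-allFin b)) (a∈ , b∈)))))

  diam-nonZero : ∀ S → 2 ℕ.≤ ∣ S ∣ → ℕ.NonZero (diam S)
  diam-nonZero S 2≤ = ℕ.>-nonZero (ℕ.≤-trans (1≤d x≢y) (d≤diam S x∈ y∈))
    where
    1≤d : ∀ {x y} → x ≢ y → 1 ℕ.≤ d x y
    1≤d {x} {y} x≢y with shortestWalk x y
    ... | zero  , [] , _ = ⊥-elim (x≢y refl)
    ... | suc k , _  , _ = s≤s z≤n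
    open Σ (two-elements S 2≤) renaming (proj₁ to x; proj₂ to rest)
    y = proj₁ rest
    x∈ = proj₁ (proj₂ rest)
    y∈ = proj₁ (proj₂ (proj₂ rest))
    x≢y = proj₂ (proj₂ (proj₂ rest))

  record Cluster : Set where
    field
      S           : Subset n
      2≤∣S∣       : 2 ℕ.≤ ∣ S ∣
      S-connected : IsConnected (Adj on proj₁ {B = _∈ₛ S})

  ratio : Cluster → ℚ
  ratio c = (+ (∣ S ∣ ℕ.∸ 1) ℚ./ diam S) {{diam-nonZero S 2≤∣S∣}}
    where open Cluster c

  IsΓ : ℚ → Set
  IsΓ = IsMaximum _≡_ ℚ._≤_ ratio

  record FreeSolution : Set where
    field
      u           : Fin n → Fin n → ℝ
      ultrametric : IsUltrametric u
      dominates   : ∀ x y → fromℕ (d x y) ≤ℝ u x y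

  freeCost : FreeSolution → ℝ
  freeCost s = cost (FreeSolution.u s)

  IsOPT-free : ℝ → Set
  IsOPT-free = IsMinimum _≈ℝ_ _≤ℝ_ freeCost

  record CardSolution : Set where
    field
      H         : Hierarchy n
      dominates : ∀ x y → d x y ℕ.≤ h H x y

  cardCost : CardSolution → ℝ
  cardCost s = cost (λ x y → fromℕ (h (CardSolution.H s) x y))

  IsOPT-card : ℝ → Set
  IsOPT-card = IsMinimum _≈ℝ_ _≤ℝ_ cardCost

{-# OPTIONS --safe #-}
module Submission where

-- Let u be an optimal ultrametric and build a hierarchy from it by single
-- linkage: starting from singletons, repeatedly join the two clusters at the
-- ends of an edge pq of G that is u-shortest among all edges between distinct
-- clusters. Let C be a cluster formed by joining A and B along pq.
--
-- * G[C] is connected, so any two vertices of C are at distance at most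
--   |C| - 1 in G; hence the hierarchy dominates d (linked-dominates).
-- * The u-diameter of C is at most u p q: all edges used so far are at most
--   u p q in length, and the strong triangle inequality propagates this bound.
--   Since d is at most u, also diam C is at most u p q.
-- * An edge xy of G whose lowest common ancestor is C runs between A and B, so
--   u p q is at most u x y by the choice of pq.
--
-- Together, h x y = |C| - 1 is at most Γ * diam C, hence at most Γ * u x y for
-- every edge xy (linked-h≤). Summing against the weights gives the claim.
--
-- Only one step is not constructive: choosing a u-shortest edge compares real
-- numbers. The order on Cauchy reals is total up to double negation, and
-- finitely many such comparisons can be made under one double negation. This
-- suffices because the conclusion, an inequality of reals, is itself stable
-- under double negation (≤ℝ-stable).

open import Data.Bool using (if_then_else_)
open import Data.Fin as Fin using (Fin)
import Data.Fin.Properties as Fin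
open import Data.Fin.Subset using (Subset; ⁅_⁆; _∪_; ⊥; ∣_∣)
  renaming (_∈_ to _∈ₛ_)
open import Data.Fin.Subset.Properties
  using (x∈⁅x⁆; x∈⁅y⁆⇒x≡y; ∉⊥; p⊂q⇒∣p∣<∣q∣; q⊆p∪q; x∈p∪q⁺; x∈p∪q⁻)
  renaming (_∈?_ to _∈ₛ?_)
open import Data.Integer as ℤ using (+_)
import Data.Integer.Properties as ℤ
open import Data.List
  using (List; []; _∷_; _++_; length; map; filter; foldr; allFin; concatMap)
open import Data.List.Extrema.Nat using (max; argmax-all)
import Data.List.Membership.DecPropositional as DecMembership
open import Data.List.Membership.Propositional using (_∈_; _∉_; find)
open import Data.List.Membership.Propositional.Properties
  using (∈-allFin; ∈-cartesianProduct⁺; ∈-filter⁺; ∈-filter⁻; ∈-++⁺ˡ; ∈-++⁺ʳ; ∈-++⁻;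
         ∈-∃++; ∈-concatMap⁺; ∈-concatMap⁻)
open import Data.List.Properties
  using (length-++; ++-assoc; ++-identityʳ; length-map; length-tabulate)
open import Data.List.Relation.Binary.Permutation.Propositional
  using (_↭_; prep; ↭-refl; ↭-sym; ↭-trans; ↭-reflexive; ↭⇒↭ₛ)
open import Data.List.Relation.Binary.Permutation.Propositional.Properties
  using (∈-resp-↭; Any-resp-↭; All-resp-↭; shift; shifts; ++⁺ˡ; ↭-length)
import Data.List.Relation.Binary.Permutation.Setoid.Properties as ↭ₛ
open import Data.List.Relation.Unary.All as All using (All; []; _∷_)
import Data.List.Relation.Unary.All.Properties as All
open import Data.List.Relation.Unary.AllPairs using ([]; _∷_)
open import Data.List.Relation.Unary.Any as Any using (Any; here; there)
open import Data.List.Relation.Unary.Unique.Propositional using (Unique)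
open import Data.List.Relation.Unary.Unique.Propositional.Properties using (allFin⁺)
open import Data.Nat as ℕ using (ℕ; zero; suc; _≤_; z≤n; s≤s)
import Data.Nat.Properties as ℕ
open import Data.Product using (∃; ∃₂; _×_; _,_; proj₁; proj₂)
open import Data.Rational as ℚ using (ℚ; 0ℚ; ½)
import Data.Rational.Properties as ℚ
open import Data.Rational.Solver using (module +-*-Solver)
import Data.Rational.Unnormalised as ℚᵘ
import Data.Rational.Unnormalised.Properties as ℚᵘ
open import Data.Sum using (_⊎_; inj₁; inj₂; [_,_]′)
open import Data.Tree.Binary using (Tree; leaf; node; module Leaves)
open import Data.Unit using (⊤; tt)
open import Data.Vec.Properties.WithK using ([]=-irrelevant)
open import Effect.Monad using (RawMonad)
open import Function using (_on_; _∘_; id)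
open import Function.Metric.Structures using (IsGeneralMetric)
open import Level using (0ℓ)
open import Relation.Binary using (Rel; IsPartialOrder; _⇒_)
open import Relation.Binary.PropositionalEquality
  using (_≡_; _≢_; refl; sym; trans; cong; subst; subst₂; setoid)
open import Relation.Nullary using (Dec; does; ¬_; yes; no; ¬?; _×-dec_; contradiction)
open import Relation.Nullary.Negation using (¬¬-map; ¬¬-Monad)
import Relation.Unary as Unary
open import Defs

-- Order and arithmetic of Cauchy reals

module ≤ℝ = IsPartialOrder ≤ℝ-isPartialOrder

pointwise⇒≤ℝ : ∀ {x y} → (∀ n → seq x n ℚ.≤ seq y n) → x ≤ℝ y
pointwise⇒≤ℝ {x} {y} p .below ε 0<ε = 0 , λ n _ → ℚ.≤-trans (p n)
  (subst (ℚ._≤ seq y n ℚ.+ ε) (ℚ.+-identityʳ (seq y n))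
    (ℚ.+-monoʳ-≤ (seq y n) (ℚ.<⇒≤ 0<ε)))

-- These alternatives overlap, so comparing the two sides up to ε / 8, through
-- their terms at one index K, decides between them; x ≤ℝ y itself is not
-- decidable.
≤+ε⊎> : ∀ x y ε → 0ℚ ℚ.< ε →
        (∃ λ N → ∀ n → N ℕ.≤ n → seq x n ℚ.≤ seq y n ℚ.+ ε) ⊎ y <ℝ x
≤+ε⊎> x y ε 0<ε = split (seq x K ℚ.≤? seq y K ℚ.+ ε ℚ.* ¾)
  where
  open +-*-Solver
  open ℚ.≤-Reasoning
  ⅛ = + 1 ℚ./ 8
  ¾ = + 3 ℚ./ 4
  δ = ε ℚ.* ⅛
  M = proj₁ (cauchy x δ (0<* 0<ε (ℚ.positive⁻¹ ⅛)))
  N = proj₁ (cauchy y δ (0<* 0<ε (ℚ.positive⁻¹ ⅛)))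
  K = M ℕ.⊔ N
  hx = proj₂ (cauchy x δ (0<* 0<ε (ℚ.positive⁻¹ ⅛)))
  hy = proj₂ (cauchy y δ (0<* 0<ε (ℚ.positive⁻¹ ⅛)))

  move : ∀ z {L} → (∀ m n → L ℕ.≤ m → L ℕ.≤ n → ℚ.∣ seq z m ℚ.- seq z n ∣ ℚ.≤ δ) →
         ∀ m n → L ℕ.≤ m → L ℕ.≤ n → seq z m ℚ.≤ seq z n ℚ.+ δ
  move z hz m n m≥ n≥ = -≤⇒≤+ (seq z m) (seq z n) (hz m n m≥ n≥)

  module _ (n : ℕ) (n≥ : K ℕ.≤ n) where
    M≤n = ℕ.m⊔n≤o⇒m≤o M N n≥
    N≤n = ℕ.m⊔n≤o⇒n≤o M N n≥
    M≤K = ℕ.m≤m⊔n M N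
    N≤K = ℕ.m≤n⊔m M N

    left : seq x K ℚ.≤ seq y K ℚ.+ ε ℚ.* ¾ → seq x n ℚ.≤ seq y n ℚ.+ ε
    left le = begin
      seq x n                              ≤⟨ move x hx n K M≤n M≤K ⟩
      seq x K ℚ.+ δ                        ≤⟨ ℚ.+-monoˡ-≤ δ le ⟩
      seq y K ℚ.+ ε ℚ.* ¾ ℚ.+ δ            ≤⟨ ℚ.+-monoˡ-≤ δ (ℚ.+-monoˡ-≤ (ε ℚ.* ¾) (move y hy K n N≤K N≤n)) ⟩
      seq y n ℚ.+ δ ℚ.+ ε ℚ.* ¾ ℚ.+ δ
        ≡⟨ solve 2 (λ b e → b :+ e :* con ⅛ :+ e :* con ¾ :+ e :* con ⅛ := b :+ e) refl (seq y n) ε ⟩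
      seq y n ℚ.+ ε                        ∎

    right : seq y K ℚ.+ ε ℚ.* ¾ ℚ.< seq x K → seq y n ℚ.+ ε ℚ.* ½ ℚ.≤ seq x n
    right lt = begin
      seq y n ℚ.+ ε ℚ.* ½                  ≤⟨ ℚ.+-monoˡ-≤ (ε ℚ.* ½) (move y hy n K N≤n N≤K) ⟩
      seq y K ℚ.+ δ ℚ.+ ε ℚ.* ½
        ≡⟨ solve 2 (λ b e → b :+ e :* con ⅛ :+ e :* con ½ := (b :+ e :* con ¾) :- e :* con ⅛) refl (seq y K) ε ⟩
      (seq y K ℚ.+ ε ℚ.* ¾) ℚ.- δ          ≤⟨ ℚ.+-monoˡ-≤ (ℚ.- δ) (ℚ.<⇒≤ lt) ⟩
      seq x K ℚ.- δ                        ≤⟨ ℚ.+-monoˡ-≤ (ℚ.- δ) (move x hx K n M≤K M≤n) ⟩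
      seq x n ℚ.+ δ ℚ.- δ                  ≡⟨ solve 2 (λ a d → a :+ d :- d := a) refl (seq x n) δ ⟩
      seq x n                              ∎

  split : _ → _
  split (yes le)  = inj₁ (K , λ n n≥ → left n n≥ le)
  split (no  nle) = inj₂ (ε ℚ.* ½ , 0<* 0<ε 0<½ , K , λ n n≥ → right n n≥ (ℚ.≰⇒> nle))

<ℝ⇒≱ℝ : ∀ {x y} → x <ℝ y → ¬ y ≤ℝ x
<ℝ⇒≱ℝ {x} {y} (ε , 0<ε , M , p) y≤x =
  let (N , q) = below y≤x (ε ℚ.* ½) (0<* 0<ε 0<½)
      K = M ℕ.⊔ N
      ε≤½ε : ε ℚ.≤ ε ℚ.* ½
      ε≤½ε = subst₂ ℚ._≤_ (solve 2 (λ a e → :- a :+ (a :+ e) := e) refl (seq x K) ε)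
                          (solve 2 (λ a e → :- a :+ (a :+ e) := e) refl (seq x K) (ε ℚ.* ½))
        (ℚ.+-monoʳ-≤ (ℚ.- seq x K)
          (ℚ.≤-trans (p K (ℕ.m≤m⊔n M N)) (q K (ℕ.m≤n⊔m M N))))
      ½ε<ε : ε ℚ.* ½ ℚ.< ε
      ½ε<ε = subst₂ ℚ._<_ (ℚ.+-identityʳ (ε ℚ.* ½)) (half+half ε)
        (ℚ.+-monoʳ-< (ε ℚ.* ½) (0<* 0<ε 0<½))
  in ℚ.<-irrefl refl (ℚ.<-≤-trans ½ε<ε ε≤½ε)
  where open +-*-Solver

<ℝ⇒≤ℝ : ∀ {x y} → x <ℝ y → x ≤ℝ y
<ℝ⇒≤ℝ {x} {y} (ε , 0<ε , N , p) .below δ 0<δ = N , λ n n≥ →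
  subst (ℚ._≤ seq y n ℚ.+ δ) (ℚ.+-identityʳ (seq x n))
    (ℚ.+-mono-≤
      (ℚ.≤-trans (subst (ℚ._≤ seq x n ℚ.+ ε) (ℚ.+-identityʳ (seq x n))
                   (ℚ.+-monoʳ-≤ (seq x n) (ℚ.<⇒≤ 0<ε)))
                 (p n n≥))
      (ℚ.<⇒≤ 0<δ))

≮ℝ⇒≥ℝ : ∀ {x y} → ¬ x <ℝ y → y ≤ℝ x
≮ℝ⇒≥ℝ {x} {y} x≮y .below ε 0<ε with ≤+ε⊎> y x ε 0<ε
... | inj₁ y≤x+ε = y≤x+ε
... | inj₂ x<y   = contradiction x<y x≮y

-- Double-negation stability is what lets a proof of an inequality assume
-- that finitely many reals have been sorted.
≤ℝ-stable : ∀ {x y} → ¬ ¬ x ≤ℝ y → x ≤ℝ y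
≤ℝ-stable ¬¬x≤y = ≮ℝ⇒≥ℝ λ y<x → ¬¬x≤y (<ℝ⇒≱ℝ y<x)

≤ℝ-¬¬total : ∀ x y → ¬ ¬ (x ≤ℝ y ⊎ y ≤ℝ x)
≤ℝ-¬¬total x y ¬total = ¬total (inj₁ (≮ℝ⇒≥ℝ λ y<x → ¬total (inj₂ (<ℝ⇒≤ℝ y<x))))

+ℝ-mono-≤ : ∀ {x y x′ y′} → x ≤ℝ y → x′ ≤ℝ y′ → (x +ℝ x′) ≤ℝ (y +ℝ y′)
+ℝ-mono-≤ {x} {y} {x′} {y′} p q .below ε 0<ε =
  let (M , f) = below p (ε ℚ.* ½) (0<* 0<ε 0<½)
      (N , g) = below q (ε ℚ.* ½) (0<* 0<ε 0<½)
  in M ℕ.⊔ N , λ n n≥ → subst (seq x n ℚ.+ seq x′ n ℚ.≤_)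
       (trans (solve 3 (λ a b e → (a :+ e) :+ (b :+ e) := (a :+ b) :+ (e :+ e)) refl
                 (seq y n) (seq y′ n) (ε ℚ.* ½))
              (cong (seq y n ℚ.+ seq y′ n ℚ.+_) (half+half ε)))
       (ℚ.+-mono-≤ (f n (ℕ.m⊔n≤o⇒m≤o M N n≥)) (g n (ℕ.m⊔n≤o⇒n≤o M N n≥)))
  where open +-*-Solver

⊔ℝ-lub : ∀ {x y z} → x ≤ℝ z → y ≤ℝ z → (x ⊔ℝ y) ≤ℝ z
⊔ℝ-lub x≤z y≤z .below ε 0<ε =
  let (M , p) = below x≤z ε 0<ε
      (N , q) = below y≤z ε 0<ε
  in M ℕ.⊔ N , λ n n≥ →
     ℚ.⊔-lub (p n (ℕ.m⊔n≤o⇒m≤o M N n≥)) (q n (ℕ.m⊔n≤o⇒n≤o M N n≥))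

-- The sequence is nonnegative from some index on. This is stronger than
-- 0ℝ ≤ℝ x, depends on the representative, and holds for positive reals and for
-- nonnegative constant sequences.
EventuallyNonneg : ℝ → Set
EventuallyNonneg x = ∃ λ N → ∀ n → N ℕ.≤ n → 0ℚ ℚ.≤ seq x n

0<ℝ⇒eventuallyNonneg : ∀ {x} → 0ℝ <ℝ x → EventuallyNonneg x
0<ℝ⇒eventuallyNonneg (ε , 0<ε , N , p) = N , λ n n≥ →
  ℚ.≤-trans (ℚ.<⇒≤ 0<ε) (subst (ℚ._≤ _) (ℚ.+-identityˡ ε) (p n n≥))

*ℝ-monoʳ-≤ : ∀ c {x y} → EventuallyNonneg c → x ≤ℝ y → (c *ℝ x) ≤ℝ (c *ℝ y)
*ℝ-monoʳ-≤ c {x} {y} (K , 0≤c) x≤y .below ε 0<ε =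
  let (B , 0<B , L , c≤B) = bounded c
      (δ , 0<δ , Bδ≡ε)    = quotient 0<ε 0<B
      (N , p)             = below x≤y δ 0<δ
  in (K ℕ.⊔ L) ℕ.⊔ N , λ n n≥ →
     let KL≤n = ℕ.m⊔n≤o⇒m≤o (K ℕ.⊔ L) N n≥
         0≤cₙ = 0≤c n (ℕ.m⊔n≤o⇒m≤o K L KL≤n)
         cₙ≤B = subst (ℚ._≤ B) (ℚ.0≤p⇒∣p∣≡p 0≤cₙ) (c≤B n (ℕ.m⊔n≤o⇒n≤o K L KL≤n))
     in begin
       seq c n ℚ.* seq x n                        ≤⟨ ℚ.*-monoˡ-≤-nonNeg (seq c n) {{ℚ.nonNegative 0≤cₙ}}
                                                       (p n (ℕ.m⊔n≤o⇒n≤o (K ℕ.⊔ L) N n≥)) ⟩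
       seq c n ℚ.* (seq y n ℚ.+ δ)                ≡⟨ ℚ.*-distribˡ-+ (seq c n) (seq y n) δ ⟩
       seq c n ℚ.* seq y n ℚ.+ seq c n ℚ.* δ      ≤⟨ ℚ.+-monoʳ-≤ (seq c n ℚ.* seq y n)
                                                       (ℚ.*-monoʳ-≤-nonNeg δ {{ℚ.nonNegative (ℚ.<⇒≤ 0<δ)}} cₙ≤B) ⟩
       seq c n ℚ.* seq y n ℚ.+ B ℚ.* δ            ≡⟨ cong (seq c n ℚ.* seq y n ℚ.+_) Bδ≡ε ⟩
       seq c n ℚ.* seq y n ℚ.+ ε                  ∎
  where open ℚ.≤-Reasoning

-- A termwise bound by the factor c survives weighting and summation.
weightedSum-≤ : ∀ {A : Set} (c : ℚ) (w f g : A → ℝ) {es : List A} →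
  All (λ e → EventuallyNonneg (w e) × f e ≤ℝ fromℚ c *ℝ g e) es →
  sumℝ (map (λ e → w e *ℝ f e) es) ≤ℝ fromℚ c *ℝ sumℝ (map (λ e → w e *ℝ g e) es)
weightedSum-≤ c w f g [] = pointwise⇒≤ℝ λ _ → ℚ.≤-reflexive (sym (ℚ.*-zeroʳ c))
weightedSum-≤ c w f g {e ∷ es} ((w≥0 , f≤cg) ∷ all) =
  ≤ℝ.trans
    (+ℝ-mono-≤ (*ℝ-monoʳ-≤ (w e) w≥0 f≤cg) (weightedSum-≤ c w f g all))
    (pointwise⇒≤ℝ λ n → ℚ.≤-reflexive
      (solve 4 (λ w c g s → w :* (c :* g) :+ c :* s := c :* (w :* g :+ s)) refl
        (seq (w e) n) c (seq (g e) n) (seq (sumℝ (map (λ e → w e *ℝ g e) es)) n)))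
  where open +-*-Solver

fromℕ-mono-≤ : ∀ {k l} → k ℕ.≤ l → fromℕ k ≤ℝ fromℕ l
fromℕ-mono-≤ {k} {l} k≤l = pointwise⇒≤ℝ λ _ → ℚ.toℚᵘ-cancel-≤ (begin
  ℚ.toℚᵘ (+ k ℚ./ 1)  ≃⟨ ℚ.toℚᵘ-fromℚᵘ (ℚᵘ.mkℚᵘ (+ k) 0) ⟩
  ℚᵘ.mkℚᵘ (+ k) 0     ≤⟨ ℚᵘ.*≤* (ℤ.*-monoʳ-≤-nonNeg (+ 1) (ℤ.+≤+ k≤l)) ⟩
  ℚᵘ.mkℚᵘ (+ l) 0     ≃⟨ ℚ.toℚᵘ-fromℚᵘ (ℚᵘ.mkℚᵘ (+ l) 0) ⟨
  ℚ.toℚᵘ (+ l ℚ./ 1)  ∎)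
  where open ℚᵘ.≤-Reasoning

m/n*n≡m : ∀ m n .{{_ : ℕ.NonZero n}} → (+ m ℚ./ n) ℚ.* (+ n ℚ./ 1) ≡ + m ℚ./ 1
m/n*n≡m m n@(ℕ.suc k) = ℚ.toℚᵘ-injective (begin-equality
  ℚ.toℚᵘ ((+ m ℚ./ n) ℚ.* (+ n ℚ./ 1))             ≃⟨ ℚ.toℚᵘ-homo-* (+ m ℚ./ n) (+ n ℚ./ 1) ⟩
  ℚ.toℚᵘ (+ m ℚ./ n) ℚᵘ.* ℚ.toℚᵘ (+ n ℚ./ 1)
    ≃⟨ ℚᵘ.*-cong (ℚ.toℚᵘ-fromℚᵘ (ℚᵘ.mkℚᵘ (+ m) k)) (ℚ.toℚᵘ-fromℚᵘ (ℚᵘ.mkℚᵘ (+ n) 0)) ⟩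
  ℚᵘ.mkℚᵘ (+ m) k ℚᵘ.* ℚᵘ.mkℚᵘ (+ n) 0
    ≃⟨ ℚᵘ.*≡* (trans (ℤ.*-identityʳ (+ m ℤ.* + n)) (cong (λ z → + m ℤ.* + z) (sym (ℕ.*-identityʳ n)))) ⟩
  ℚᵘ.mkℚᵘ (+ m) 0                                  ≃⟨ ℚ.toℚᵘ-fromℚᵘ (ℚᵘ.mkℚᵘ (+ m) 0) ⟨
  ℚ.toℚᵘ (+ m ℚ./ 1)                               ∎)
  where open ℚᵘ.≤-Reasoning

-- Walks, lists and subsets

module _ {V : Set} {R : Rel V 0ℓ} where

  infixr 5 _++ʷ_

  _++ʷ_ : ∀ {k l x y z} → Walk R k x y → Walk R l y z → Walk R (k ℕ.+ l) x z
  []      ++ʷ q = q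
  (r ∷ p) ++ʷ q = r ∷ (p ++ʷ q)

  mapʷ : ∀ {S : Rel V 0ℓ} → R ⇒ S → ∀ {k x y} → Walk R k x y → Walk S k x y
  mapʷ f []      = []
  mapʷ f (r ∷ p) = f r ∷ mapʷ f p

unique-++⁻ : ∀ {A : Set} (xs : List A) {ys} → Unique (xs ++ ys) →
             Unique xs × Unique ys × (∀ {x} → x ∈ xs → x ∉ ys)
unique-++⁻ []       u         = [] , u , λ ()
unique-++⁻ (x ∷ xs) (x≢ ∷ u) =
  let (uxs , uys , disj) = unique-++⁻ xs u
  in All.++⁻ˡ xs x≢ ∷ uxs , uys , λ
     { (here refl) x∈ys → All.lookup (All.++⁻ʳ xs x≢) x∈ys refl
     ; (there x∈)  x∈ys → disj x∈ x∈ys }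

max-all : (P : ℕ → Set) → ∀ ks → P 0 → All P ks → P (max 0 ks)
max-all P ks = argmax-all id {P = P} {⊥ = 0} {xs = ks}

-- An element can be brought to the front of a list.
∈-select : ∀ {A : Set} {x : A} {xs} → x ∈ xs → ∃ λ ys → xs ↭ x ∷ ys
∈-select {x = x} x∈ with ys , zs , refl ← ∈-∃++ x∈ = ys ++ zs , shift x ys zs

concatMap-↭ : ∀ {A B : Set} (f : A → List B) {xs ys} → xs ↭ ys → concatMap f xs ↭ concatMap f ys
concatMap-↭ f _↭_.refl         = ↭-refl
concatMap-↭ f (prep x p)       = ++⁺ˡ (f x) (concatMap-↭ f p)
concatMap-↭ f (_↭_.swap x y p) =
  ↭-trans (shifts (f x) (f y)) (++⁺ˡ (f y) (++⁺ˡ (f x) (concatMap-↭ f p)))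
concatMap-↭ f (_↭_.trans p q)  = ↭-trans (concatMap-↭ f p) (concatMap-↭ f q)

↭allFin⇒unique : ∀ {n} {xs : List (Fin n)} → xs ↭ allFin n → Unique xs
↭allFin⇒unique {n} p = ↭ₛ.Unique-resp-↭ (setoid (Fin n)) (↭⇒↭ₛ (↭-sym p)) (allFin⁺ n)

-- A finite nonempty set has a least element for any total preorder; only
-- nonemptiness is used of the given membership.
minimal : ∀ {A : Set} {_≼_ : Rel A 0ℓ} → (∀ {x y z} → x ≼ y → y ≼ z → x ≼ z) →
          (∀ x y → x ≼ y ⊎ y ≼ x) →
          ∀ {x xs} → x ∈ xs → ∃ λ m → m ∈ xs × (∀ {y} → y ∈ xs → m ≼ y)
minimal {A} {_≼_} ≼-trans total {xs = x ∷ xs} _ = go x xs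
  where
  go : ∀ x xs → ∃ λ m → m ∈ x ∷ xs × (∀ {y} → y ∈ x ∷ xs → m ≼ y)
  go x []        = x , here refl , λ { (here refl) → [ id , id ]′ (total x x) }
  go x (x′ ∷ xs) with go x′ xs
  ... | m , m∈ , m≼ with total x m
  ...   | inj₁ x≼m = x , here refl , λ
            { (here refl) → [ id , id ]′ (total x x) ; (there y∈) → ≼-trans x≼m (m≼ y∈) }
  ...   | inj₂ m≼x = m , there m∈ , λ { (here refl) → m≼x ; (there y∈) → m≼ y∈ }

-- The set of elements of a list; repetitions are forgotten, so the size of
-- the set is the length of the list only for duplicate-free lists.
fromList : ∀ {n} → List (Fin n) → Subset n
fromList = foldr (λ x S → ⁅ x ⁆ ∪ S) ⊥

∈-fromList⁺ : ∀ {n} {x : Fin n} {xs} → x ∈ xs → x ∈ₛ fromList xs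
∈-fromList⁺ {x = x} (here refl) = x∈p∪q⁺ (inj₁ (x∈⁅x⁆ x))
∈-fromList⁺         (there x∈)  = x∈p∪q⁺ (inj₂ (∈-fromList⁺ x∈))

∈-fromList⁻ : ∀ {n} {x : Fin n} xs → x ∈ₛ fromList xs → x ∈ xs
∈-fromList⁻ []       x∈ = contradiction x∈ ∉⊥
∈-fromList⁻ (y ∷ xs) x∈ with x∈p∪q⁻ ⁅ y ⁆ (fromList xs) x∈
... | inj₁ x∈y = here (x∈⁅y⁆⇒x≡y y x∈y)
... | inj₂ x∈s = there (∈-fromList⁻ xs x∈s)

length≤∣fromList∣ : ∀ {n} {xs : List (Fin n)} → Unique xs → length xs ℕ.≤ ∣ fromList xs ∣
length≤∣fromList∣ []                = z≤n
length≤∣fromList∣ {xs = x ∷ xs} (x≢ ∷ u) = ℕ.≤-<-trans (length≤∣fromList∣ u)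
  (p⊂q⇒∣p∣<∣q∣ (q⊆p∪q ⁅ x ⁆ (fromList xs) , x , x∈p∪q⁺ (inj₁ (x∈⁅x⁆ x))
    , λ x∈ → All.lookup x≢ (∈-fromList⁻ xs x∈) refl))

-- Leaves of trees

leafList : ∀ {n} → Tree ⊤ (Fin n) → List (Fin n)
leafList = Leaves.toList

-- The leaves are collected with difference lists, so this does not hold by
-- computation.
leafList-node : ∀ {n} (a b : Tree ⊤ (Fin n)) →
                leafList (node a tt b) ≡ leafList a ++ leafList b
leafList-node a b = toDiffList-++ a (leafList b)
  where
  toDiffList-++ : ∀ {n} (t : Tree ⊤ (Fin n)) xs →
                  Leaves.toDiffList t xs ≡ leafList t ++ xs
  toDiffList-++ (leaf x)     xs = refl
  toDiffList-++ (node l _ r) xs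
    rewrite toDiffList-++ l (Leaves.toDiffList r xs)
          | toDiffList-++ r xs
          | toDiffList-++ l (Leaves.toDiffList r [])
          = sym (++-assoc (leafList l) (leafList r) xs)

module _ {n : ℕ} where

  ∈-nodeˡ : ∀ (a b : Tree ⊤ (Fin n)) {x} → x ∈ leafList a → x ∈ leafList (node a tt b)
  ∈-nodeˡ a b x∈ = subst (_ ∈_) (sym (leafList-node a b)) (∈-++⁺ˡ x∈)

  ∈-nodeʳ : ∀ (a b : Tree ⊤ (Fin n)) {x} → x ∈ leafList b → x ∈ leafList (node a tt b)
  ∈-nodeʳ a b x∈ = subst (_ ∈_) (sym (leafList-node a b)) (∈-++⁺ʳ (leafList a) x∈)

  ∈-node⁻ : ∀ (a b : Tree ⊤ (Fin n)) {x} → x ∈ leafList (node a tt b) → x ∈ leafList a ⊎ x ∈ leafList b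
  ∈-node⁻ a b x∈ = ∈-++⁻ (leafList a) (subst (_ ∈_) (leafList-node a b) x∈)

  unique-node⁻ : ∀ (a b : Tree ⊤ (Fin n)) → Unique (leafList (node a tt b)) →
                 Unique (leafList a) × Unique (leafList b)
  unique-node⁻ a b u =
    let (ua , ub , _) = unique-++⁻ (leafList a) (subst Unique (leafList-node a b) u) in ua , ub

  1≤leaves : ∀ (t : Tree ⊤ (Fin n)) → 1 ℕ.≤ length (leafList t)
  1≤leaves (leaf _)     = s≤s z≤n
  1≤leaves (node a _ b) = subst (1 ℕ.≤_)
    (sym (trans (cong length (leafList-node a b)) (length-++ (leafList a))))
    (ℕ.≤-trans (1≤leaves a) (ℕ.m≤m+n _ _))

if-yes : ∀ {P A : Set} (P? : Dec P) {x y : A} → P → (if does P? then x else y) ≡ x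
if-yes (yes _) p = refl
if-yes (no ¬p) p = contradiction p ¬p

if-no : ∀ {P A : Set} (P? : Dec P) {x y : A} → ¬ P → (if does P? then x else y) ≡ y
if-no (yes p) ¬p = contradiction p ¬p
if-no (no _)  ¬p = refl

module _ {n : ℕ} (a b : Tree ⊤ (Fin n)) {x y : Fin n} where
  open DecMembership (Fin._≟_ {n}) using (_∈?_)

  private
    inA? = x ∈? leafList a ×-dec y ∈? leafList a
    inB? = x ∈? leafList b ×-dec y ∈? leafList b

  lca-left : x ∈ leafList a × y ∈ leafList a → lca (node a tt b) x y ≡ lca a x y
  lca-left a∋ = if-yes inA? a∋

  lca-right : ¬ (x ∈ leafList a × y ∈ leafList a) → x ∈ leafList b × y ∈ leafList b →
              lca (node a tt b) x y ≡ lca b x y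
  lca-right a∌ b∋ = trans (if-no inA? a∌) (if-yes inB? b∋)

  lca-here : ¬ (x ∈ leafList a × y ∈ leafList a) → ¬ (x ∈ leafList b × y ∈ leafList b) →
             lca (node a tt b) x y ≡ node a tt b
  lca-here a∌ b∌ = trans (if-no inA? a∌) (if-no inB? b∌)

module _ {n : ℕ} (H : Hierarchy n) where
  open Hierarchy H

  h-≢ : ∀ {x y} → x ≢ y → h H x y ≡ length (leafList (lca tree x y)) ℕ.∸ 1
  h-≢ {x} {y} = if-no (x Fin.≟ y)

leaf-nonempty : ∀ {n} (t : Tree ⊤ (Fin n)) → ∃ λ x → x ∈ leafList t
leaf-nonempty (leaf x)     = x , here refl
leaf-nonempty (node a _ b) = let (x , x∈) = leaf-nonempty a in x , ∈-nodeˡ a b x∈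

-- The cardinality ratio of clusters

Γ-nonneg : ∀ {n} (G : ConnectedWeightedGraph n) {Γ} → IsΓ G Γ → EventuallyNonneg (fromℚ Γ)
Γ-nonneg G ((c , refl) , _) = 0 , λ _ _ → ℚ.nonNegative⁻¹ (ratio G c)
  {{ℚ.normalize-nonNeg (∣ S ∣ ℕ.∸ 1) (diam G S) {{diam-nonZero G S 2≤∣S∣}}}}
  where open Cluster c

cluster-≤ : ∀ {n} (G : ConnectedWeightedGraph n) {Γ} → IsΓ G Γ → ∀ c →
            fromℕ (∣ Cluster.S c ∣ ℕ.∸ 1) ≤ℝ fromℚ Γ *ℝ fromℕ (diam G (Cluster.S c))
cluster-≤ G {Γ} (_ , ratio≤Γ) c = pointwise⇒≤ℝ λ _ →
  subst (ℚ._≤ Γ ℚ.* (+ D ℚ./ 1)) (m/n*n≡m (∣ S ∣ ℕ.∸ 1) D)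
    (ℚ.*-monoʳ-≤-nonNeg (+ D ℚ./ 1) {{ℚ.normalize-nonNeg D 1}} (ratio≤Γ c))
  where
  open Cluster c
  D = diam G S
  instance
    D≢0 : ℕ.NonZero D
    D≢0 = diam-nonZero G S 2≤∣S∣

-- Single-linkage trees of an ultrametric

module _ {n : ℕ} (G : ConnectedWeightedGraph n) where
  open ConnectedWeightedGraph G

  -- Adjacency in the subgraph induced by a list of vertices.
  Inside : List (Fin n) → Rel (Fin n) 0ℓ
  Inside xs x y = Adj x y × x ∈ xs × y ∈ xs

  -- Vertices of an induced subgraph carry membership proofs, so the empty walk
  -- lifts only because such proofs are unique.
  walk⇒walkₛ : ∀ xs {k x y} → Walk (Inside xs) k x y →
               (x∈ : x ∈ₛ fromList xs) (y∈ : y ∈ₛ fromList xs) →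
               Walk (Adj on proj₁ {B = _∈ₛ fromList xs}) k (x , x∈) (y , y∈)
  walk⇒walkₛ xs [] x∈ y∈ rewrite []=-irrelevant x∈ y∈ = []
  walk⇒walkₛ xs ((e , _ , z∈) ∷ p) x∈ y∈ = e ∷ walk⇒walkₛ xs p (∈-fromList⁺ z∈) y∈

  open DecMembership (Fin._≟_ {n}) using (_∈?_)

  d-≤ : ∀ {k x y} → Walk Adj k x y → d G x y ℕ.≤ k
  d-≤ {_} {x} {y} = proj₂ (proj₂ (shortestWalk G x y))

  d-refl : ∀ x → d G x x ≡ 0
  d-refl x = ℕ.n≤0⇒n≡0 (d-≤ [])

  module SingleLinkage (u : Fin n → Fin n → ℝ) (um : IsUltrametric u)
                       (dom : ∀ x y → fromℕ (d G x y) ≤ℝ u x y) where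
    module U = IsGeneralMetric um

    -- The two parts a and b are joined by an edge pq of G whose u-length is at
    -- least every distance within the union (spread) and at most the length
    -- of every edge between the parts (gap).
    record IsMerge (a b : Tree ⊤ (Fin n)) : Set where
      field
        {p q}  : Fin n
        p∈a    : p ∈ leafList a
        q∈b    : q ∈ leafList b
        p~q    : Adj p q
        spread : ∀ {x y} → x ∈ leafList (node a tt b) → y ∈ leafList (node a tt b) →
                 u x y ≤ℝ u p q
        gap    : ∀ {x y} → x ∈ leafList a → y ∈ leafList b → Adj x y → u p q ≤ℝ u x y

    -- Hierarchies all of whose internal nodes arise as single-linkage merges.
    data Linked : Tree ⊤ (Fin n) → Set where
      leaf : ∀ {x} → Linked (leaf x)
      node : ∀ {a b} → Linked a → Linked b → IsMerge a b → Linked (node a tt b)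

    -- The subgraph induced by the leaves is connected, with walks shorter than
    -- the number of leaves: joining two parts adds their bounds, since the
    -- linking edge makes up for the strictness of one of them.
    linked⇒walk : ∀ {t} → Linked t → ∀ {x y} → x ∈ leafList t → y ∈ leafList t →
                  ∃ λ k → k ℕ.< length (leafList t) × Walk (Inside (leafList t)) k x y
    linked⇒walk leaf (here refl) (here refl) = 0 , s≤s z≤n , []
    linked⇒walk {t} (node {a} {b} la lb m) x∈ y∈ = go (∈-node⁻ a b x∈) (∈-node⁻ a b y∈)
      where
      open IsMerge m
      len : length (leafList t) ≡ length (leafList a) ℕ.+ length (leafList b)
      len = trans (cong length (leafList-node a b)) (length-++ (leafList a))
      inˡ : Inside (leafList a) ⇒ Inside (leafList t)
      inˡ (e , x∈ , y∈) = e , ∈-nodeˡ a b x∈ , ∈-nodeˡ a b y∈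
      inʳ : Inside (leafList b) ⇒ Inside (leafList t)
      inʳ (e , x∈ , y∈) = e , ∈-nodeʳ a b x∈ , ∈-nodeʳ a b y∈
      go : ∀ {x y} → x ∈ leafList a ⊎ x ∈ leafList b → y ∈ leafList a ⊎ y ∈ leafList b →
           ∃ λ k → k ℕ.< length (leafList t) × Walk (Inside (leafList t)) k x y
      go (inj₁ x∈) (inj₁ y∈) =
        let (k , k< , w) = linked⇒walk la x∈ y∈
        in k , subst (k ℕ.<_) (sym len) (ℕ.<-≤-trans k< (ℕ.m≤m+n _ _)) , mapʷ inˡ w
      go (inj₂ x∈) (inj₂ y∈) =
        let (k , k< , w) = linked⇒walk lb x∈ y∈
        in k , subst (k ℕ.<_) (sym len) (ℕ.<-≤-trans k< (ℕ.m≤n+m _ _)) , mapʷ inʳ w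
      go (inj₁ x∈) (inj₂ y∈) =
        let (k , k< , v) = linked⇒walk la x∈ p∈a
            (l , l< , w) = linked⇒walk lb q∈b y∈
        in k ℕ.+ suc l , subst (k ℕ.+ suc l ℕ.<_) (sym len) (ℕ.+-mono-<-≤ k< l<)
         , mapʷ inˡ v ++ʷ ((p~q , ∈-nodeˡ a b p∈a , ∈-nodeʳ a b q∈b) ∷ mapʷ inʳ w)
      go (inj₂ x∈) (inj₁ y∈) =
        let (k , k< , v) = linked⇒walk la p∈a y∈
            (l , l< , w) = linked⇒walk lb x∈ q∈b
        in l ℕ.+ suc k
         , subst (l ℕ.+ suc k ℕ.<_) (trans (ℕ.+-comm (length (leafList b)) _) (sym len)) (ℕ.+-mono-<-≤ l< k<)
         , mapʷ inʳ w ++ʷ ((adj-sym p~q , ∈-nodeʳ a b q∈b , ∈-nodeˡ a b p∈a) ∷ mapʷ inˡ v)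

    -- The lowest common ancestor of x and y in t is an internal node with x and
    -- y below different children.
    record LcaSplit (t : Tree ⊤ (Fin n)) (x y : Fin n) : Set where
      constructor lcaSplit
      field
        {a b}  : Tree ⊤ (Fin n)
        lca≡   : lca t x y ≡ node a tt b
        linked : Linked (node a tt b)
        unique : Unique (leafList (node a tt b))
        sides  : (x ∈ leafList a × y ∈ leafList b) ⊎ (x ∈ leafList b × y ∈ leafList a)

    linked-lca : ∀ {t} → Linked t → Unique (leafList t) → ∀ {x y} →
                 x ∈ leafList t → y ∈ leafList t → x ≢ y → LcaSplit t x y
    linked-lca leaf _ (here refl) (here refl) x≢y = contradiction refl x≢y
    linked-lca (node {a} {b} la lb m) uniq {x} {y} x∈ y∈ x≢y =
      go (x ∈? leafList a ×-dec y ∈? leafList a) (x ∈? leafList b ×-dec y ∈? leafList b)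
         (∈-node⁻ a b x∈) (∈-node⁻ a b y∈)
      where
      descend : ∀ {t} → lca (node a tt b) x y ≡ lca t x y → LcaSplit t x y →
                LcaSplit (node a tt b) x y
      descend eq s = lcaSplit (trans eq lca≡) linked unique sides
        where open LcaSplit s

      go : Dec (x ∈ leafList a × y ∈ leafList a) → Dec (x ∈ leafList b × y ∈ leafList b) →
           x ∈ leafList a ⊎ x ∈ leafList b → y ∈ leafList a ⊎ y ∈ leafList b →
           LcaSplit (node a tt b) x y
      go (yes a∋) _ _ _ = descend (lca-left a b a∋)
        (linked-lca la (proj₁ (unique-node⁻ a b uniq)) (proj₁ a∋) (proj₂ a∋) x≢y)
      go (no a∌) (yes b∋) _ _ = descend (lca-right a b a∌ b∋)
        (linked-lca lb (proj₂ (unique-node⁻ a b uniq)) (proj₁ b∋) (proj₂ b∋) x≢y)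
      go (no a∌) (no b∌) (inj₁ x∈a) (inj₁ y∈a) = contradiction (x∈a , y∈a) a∌
      go (no a∌) (no b∌) (inj₂ x∈b) (inj₂ y∈b) = contradiction (x∈b , y∈b) b∌
      go (no a∌) (no b∌) (inj₁ x∈a) (inj₂ y∈b) =
        lcaSplit (lca-here a b a∌ b∌) (node la lb m) uniq (inj₁ (x∈a , y∈b))
      go (no a∌) (no b∌) (inj₂ x∈b) (inj₁ y∈a) =
        lcaSplit (lca-here a b a∌ b∌) (node la lb m) uniq (inj₂ (x∈b , y∈a))

    -- The leaf set of an internal node, as a set over which Γ is maximised.
    linkedCluster : ∀ {a b} → Linked (node a tt b) → Unique (leafList (node a tt b)) → Cluster G
    linkedCluster {a} {b} l uniq = record
      { S           = fromList (leafList (node a tt b))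
      ; 2≤∣S∣       = ℕ.≤-trans 2≤ (length≤∣fromList∣ uniq)
      ; S-connected = λ (x , x∈) (y , y∈) →
          let xs = leafList (node a tt b)
              (k , _ , w) = linked⇒walk l (∈-fromList⁻ xs x∈) (∈-fromList⁻ xs y∈)
          in k , walk⇒walkₛ xs w x∈ y∈
      }
      where
      2≤ : 2 ℕ.≤ length (leafList (node a tt b))
      2≤ = subst (2 ℕ.≤_) (sym (trans (cong length (leafList-node a b)) (length-++ (leafList a))))
             (ℕ.+-mono-≤ (1≤leaves a) (1≤leaves b))

    -- Since u dominates d, a bound on the u-diameter bounds the d-diameter.
    diam-≤ : ∀ xs {t} → 0ℝ ≤ℝ t →
             (∀ {x y} → x ∈ xs → y ∈ xs → u x y ≤ℝ t) → fromℕ (diam G (fromList xs)) ≤ℝ t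
    diam-≤ xs {t} 0≤t u≤t = max-all (λ k → fromℕ k ≤ℝ t) distances 0≤t
      (All.map⁺ {f = λ (a , b) → d G a b} (All.tabulate d≤t))
      where
      inS? : Unary.Decidable (λ ((a , b) : Fin n × Fin n) → a ∈ₛ fromList xs × b ∈ₛ fromList xs)
      inS? (a , b) = a ∈ₛ? fromList xs ×-dec b ∈ₛ? fromList xs
      distances : List ℕ
      distances = map (λ (a , b) → d G a b) (filter inS? (pairs G))
      d≤t : ∀ {ab} → ab ∈ filter inS? (pairs G) → fromℕ (d G (proj₁ ab) (proj₂ ab)) ≤ℝ t
      d≤t {a , b} ab∈ =
        let (a∈ , b∈) = proj₂ (∈-filter⁻ inS? {xs = pairs G} ab∈)
        in ≤ℝ.trans (dom a b) (u≤t (∈-fromList⁻ xs a∈) (∈-fromList⁻ xs b∈))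

    module _ (H : Hierarchy n) (linked : Linked (Hierarchy.tree H)) where
      open Hierarchy H

      lcaOf : ∀ {x y} → x ≢ y → LcaSplit tree x y
      lcaOf {x} {y} = linked-lca linked (↭allFin⇒unique leaves) (∈tree x) (∈tree y)
        where
        ∈tree : ∀ z → z ∈ leafList tree
        ∈tree z = ∈-resp-↭ (↭-sym leaves) (∈-allFin z)

      linked-dominates : ∀ x y → d G x y ℕ.≤ h H x y
      linked-dominates x y = go (x Fin.≟ y)
        where
        separated : x ≢ y → d G x y ℕ.≤ length (leafList (lca tree x y)) ℕ.∸ 1
        separated x≢y =
          let (k , k< , w) = linked⇒walk l x∈ y∈
          in subst (λ s → d G x y ℕ.≤ length (leafList s) ℕ.∸ 1) (sym lca≡)
               (ℕ.≤-trans (d-≤ (mapʷ proj₁ w)) (ℕ.<⇒≤pred k<))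
          where
          open LcaSplit (lcaOf x≢y) renaming (linked to l)
          x∈ : x ∈ leafList (node a tt b)
          x∈ = [ ∈-nodeˡ a b ∘ proj₁ , ∈-nodeʳ a b ∘ proj₁ ]′ sides
          y∈ : y ∈ leafList (node a tt b)
          y∈ = [ ∈-nodeʳ a b ∘ proj₂ , ∈-nodeˡ a b ∘ proj₂ ]′ sides

        go : Dec (x ≡ y) → d G x y ℕ.≤ h H x y
        go (yes x≡y) = subst (λ z → d G x z ℕ.≤ h H x z) x≡y
          (subst (ℕ._≤ h H x x) (sym (d-refl x)) z≤n)
        go (no x≢y)  = subst (d G x y ℕ.≤_) (sym (h-≢ H x≢y)) (separated x≢y)

      -- With C the leaf set of the lowest common ancestor of x and y, merged
      -- along pq: |C| - 1 is at most Γ * diam C, and diam C is at most u p q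
      -- by spread, which is at most u x y by gap.
      linked-h≤ : ∀ {Γ} → IsΓ G Γ → ∀ {x y} → Adj x y →
                  fromℕ (h H x y) ≤ℝ fromℚ Γ *ℝ u x y
      linked-h≤ {Γ} isΓ {x} {y} x~y =
        subst (λ k → fromℕ k ≤ℝ fromℚ Γ *ℝ u x y)
          (sym (trans (h-≢ H x≢y) (cong (λ s → length (leafList s) ℕ.∸ 1) lca≡)))
          (bound l)
        where
        x≢y : x ≢ y
        x≢y x≡y = adj-irr x≡y x~y
        open LcaSplit (lcaOf x≢y) renaming (linked to l)
        xs = leafList (node a tt b)

        bound : Linked (node a tt b) → fromℕ (length xs ℕ.∸ 1) ≤ℝ fromℚ Γ *ℝ u x y
        bound l@(node _ _ m) = ≤ℝ.trans
          (fromℕ-mono-≤ (ℕ.∸-monoˡ-≤ 1 (length≤∣fromList∣ unique)))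
          (≤ℝ.trans (cluster-≤ G isΓ (linkedCluster l unique))
            (*ℝ-monoʳ-≤ (fromℚ Γ) (Γ-nonneg G isΓ) (diam-≤ xs (U.nonNegative {x} {y})
              λ z∈ w∈ → ≤ℝ.trans (spread z∈ w∈) (gap≤ sides))))
          where
          open IsMerge m
          gap≤ : (x ∈ leafList a × y ∈ leafList b) ⊎ (x ∈ leafList b × y ∈ leafList a) →
                 u p q ≤ℝ u x y
          gap≤ (inj₁ (x∈a , y∈b)) = gap x∈a y∈b x~y
          gap≤ (inj₂ (x∈b , y∈a)) =
            ≤ℝ.trans (gap y∈a x∈b (adj-sym x~y)) (≤ℝ.reflexive (U.sym y x))

-- Construction of a single-linkage hierarchy

module _ {n : ℕ} where
  open DecMembership (Fin._≟_ {n}) using (_∈?_)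

  -- A walk that leaves a set traverses an edge out of it.
  exit : ∀ {R : Rel (Fin n) 0ℓ} xs {k x y} → Walk R k x y → x ∈ xs → y ∉ xs →
         ∃₂ λ p q → R p q × p ∈ xs × q ∉ xs
  exit xs [] x∈ y∉ = contradiction x∈ y∉
  exit xs (_∷_ {y = z} r w) x∈ y∉ with z ∈? xs
  ... | yes z∈ = exit xs w z∈ y∉
  ... | no z∉  = _ , z , r , x∈ , z∉

  -- The trees built so far, one for each current cluster.
  Forest : Set
  Forest = List (Tree ⊤ (Fin n))

  -- Some tree of the forest has both x and y among its leaves.
  SameTree : Forest → Rel (Fin n) 0ℓ
  SameTree F x y = Any (λ t → x ∈ leafList t × y ∈ leafList t) F

  sameTree? : ∀ F x y → Dec (SameTree F x y)
  sameTree? F x y = Any.any? (λ t → x ∈? leafList t ×-dec y ∈? leafList t) F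

module _ {n : ℕ} (G : ConnectedWeightedGraph n)
         (u : Fin n → Fin n → ℝ) (um : IsUltrametric u)
         (dom : ∀ x y → fromℕ (d G x y) ≤ℝ u x y)
         (total : ∀ p q r s → u p q ≤ℝ u r s ⊎ u r s ≤ℝ u p q) where
  open ConnectedWeightedGraph G
  open SingleLinkage G u um dom

  ultra : ∀ {x y z t} → u x y ≤ℝ t → u y z ≤ℝ t → u x z ≤ℝ t
  ultra {x} {y} {z} p q = ≤ℝ.trans (U.triangle x y z) (⊔ℝ-lub p q)

  -- The leaf sets partition the vertices (cover). An edge crosses the forest
  -- if no tree contains both its ends; every crossing edge is at least as
  -- u-long as every pair of vertices of a common tree (cut≥).
  record Invariant (F : Forest) : Set where
    field
      linked : All Linked F
      cover  : concatMap leafList F ↭ allFin n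
      cut≥   : ∀ {p q} → Adj p q → ¬ SameTree F p q →
               ∀ {x y} → SameTree F x y → u x y ≤ℝ u p q

  invariant-↭ : ∀ {F F′} → F ↭ F′ → Invariant F → Invariant F′
  invariant-↭ p inv = record
    { linked = All-resp-↭ p linked
    ; cover  = ↭-trans (concatMap-↭ leafList (↭-sym p)) cover
    ; cut≥   = λ e ¬same same → cut≥ e (¬same ∘ Any-resp-↭ p) (Any-resp-↭ (↭-sym p) same)
    }
    where open Invariant inv

  singletons : Forest
  singletons = map leaf (allFin n)

  singletons-invariant : Invariant singletons
  singletons-invariant = record
    { linked = All.map⁺ (All.tabulate λ _ → leaf)
    ; cover  = ↭-reflexive (concatMap-leaf (allFin n))
    ; cut≥   = λ {p} {q} _ _ same → same-leaf (allFin n) same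
    }
    where
    concatMap-leaf : ∀ xs → concatMap leafList (map leaf xs) ≡ xs
    concatMap-leaf []       = refl
    concatMap-leaf (x ∷ xs) = cong (x ∷_) (concatMap-leaf xs)
    -- Within a singleton tree the only distance is 0.
    same-leaf : ∀ xs {p q x y} → SameTree (map leaf xs) x y → u x y ≤ℝ u p q
    same-leaf (z ∷ zs) {p} {q} (here (here refl , here refl)) =
      ≤ℝ.trans (≤ℝ.reflexive (U.≈⇒0 refl)) (U.nonNegative {p} {q})
    same-leaf (z ∷ zs) (there s) = same-leaf zs s

  -- A walk from the first tree to the second has to leave the first.
  crossing-edge : ∀ {a b F} → Invariant (a ∷ b ∷ F) →
                  ∃₂ λ p q → Adj p q × ¬ SameTree (a ∷ b ∷ F) p q
  crossing-edge {a} {b} {F} inv =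
    let (x , x∈a) = leaf-nonempty a
        (y , y∈b) = leaf-nonempty b
        (p , q , p~q , p∈a , q∉a) = exit (leafList a) (proj₂ (connected x y)) x∈a
          (λ y∈a → disjoint y∈a (∈-++⁺ˡ y∈b))
    in p , q , p~q , λ
       { (here (_ , q∈a)) → q∉a q∈a
       ; (there same) → disjoint p∈a (∈-concatMap⁺ leafList (Any.map proj₁ same)) }
    where
    disjoint = proj₂ (proj₂ (unique-++⁻ (leafList a) (↭allFin⇒unique (Invariant.cover inv))))

  -- A crossing edge of least u-length.
  record LeastCrossing (F : Forest) : Set where
    field
      {p q}    : Fin n
      p~q      : Adj p q
      crosses  : ¬ SameTree F p q
      isLeast  : ∀ {x y} → Adj x y → ¬ SameTree F x y → u p q ≤ℝ u x y

  leastCrossing : ∀ {a b F} → Invariant (a ∷ b ∷ F) → LeastCrossing (a ∷ b ∷ F)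
  leastCrossing {a} {b} {F} inv =
    let (_ , _ , e , c)        = crossing-edge inv
        (_ , pq∈ , least)      = minimal {_≼_ = λ (p , q) (r , s) → u p q ≤ℝ u r s} ≤ℝ.trans
                                   (λ (p , q) (r , s) → total p q r s) (crossing⁺ e c)
        (_ , p~q , crosses)    = ∈-filter⁻ crossing? {xs = pairs G} pq∈
    in record { p~q = p~q ; crosses = crosses ; isLeast = λ e c → least (crossing⁺ e c) }
    where
    crossing? = λ (p , q) → adj? p q ×-dec ¬? (sameTree? (a ∷ b ∷ F) p q)
    crossing⁺ : ∀ {p q} → Adj p q → ¬ SameTree (a ∷ b ∷ F) p q → (p , q) ∈ filter crossing? (pairs G)
    crossing⁺ {p} {q} e c = ∈-filter⁺ crossing? (∈-cartesianProduct⁺ (∈-allFin p) (∈-allFin q)) (e , c)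

  -- Joining the trees at the ends of a least crossing edge pq preserves the
  -- invariant: by the strong triangle inequality through p and q, all
  -- distances in the union are at most u p q, which is at most the length of
  -- any edge that still crosses.
  merge : ∀ {a b F} → Invariant (a ∷ b ∷ F) → (ℓ : LeastCrossing (a ∷ b ∷ F)) →
          LeastCrossing.p ℓ ∈ leafList a → LeastCrossing.q ℓ ∈ leafList b →
          Invariant (node a tt b ∷ F)
  merge {a} {b} {F} inv ℓ p∈a q∈b = record
    { linked = node la lb isMerge ∷ lF
    ; cover  = ↭-trans (↭-reflexive (trans
                 (cong (_++ concatMap leafList F) (leafList-node a b))
                 (++-assoc (leafList a) (leafList b) _))) cover
    ; cut≥   = λ e ¬same → λ
        { (here (x∈ , y∈)) → ≤ℝ.trans (spread x∈ y∈) (isLeast e (¬same ∘ coarsen))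
        ; (there same)     → cut≥ e (¬same ∘ coarsen) (there (there same)) }
    }
    where
    open Invariant inv
    open LeastCrossing ℓ
    la = All.head linked
    lb = All.head (All.tail linked)
    lF = All.tail (All.tail linked)

    coarsen : ∀ {x y} → SameTree (a ∷ b ∷ F) x y → SameTree (node a tt b ∷ F) x y
    coarsen (here (x∈ , y∈))         = here (∈-nodeˡ a b x∈ , ∈-nodeˡ a b y∈)
    coarsen (there (here (x∈ , y∈))) = here (∈-nodeʳ a b x∈ , ∈-nodeʳ a b y∈)
    coarsen (there (there same))     = there same

    a≤ : ∀ {x y} → x ∈ leafList a → y ∈ leafList a → u x y ≤ℝ u p q
    a≤ x∈ y∈ = cut≥ p~q crosses (here (x∈ , y∈))
    b≤ : ∀ {x y} → x ∈ leafList b → y ∈ leafList b → u x y ≤ℝ u p q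
    b≤ x∈ y∈ = cut≥ p~q crosses (there (here (x∈ , y∈)))
    ab≤ : ∀ {x y} → x ∈ leafList a → y ∈ leafList b → u x y ≤ℝ u p q
    ab≤ x∈ y∈ = ultra (a≤ x∈ p∈a) (ultra ≤ℝ.refl (b≤ q∈b y∈))

    spread : ∀ {x y} → x ∈ leafList (node a tt b) → y ∈ leafList (node a tt b) → u x y ≤ℝ u p q
    spread x∈ y∈ = go (∈-node⁻ a b x∈) (∈-node⁻ a b y∈)
      where
      go : ∀ {x y} → x ∈ leafList a ⊎ x ∈ leafList b → y ∈ leafList a ⊎ y ∈ leafList b →
           u x y ≤ℝ u p q
      go (inj₁ x∈) (inj₁ y∈) = a≤ x∈ y∈
      go (inj₁ x∈) (inj₂ y∈) = ab≤ x∈ y∈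
      go {x} {y} (inj₂ x∈) (inj₁ y∈) = ≤ℝ.trans (≤ℝ.reflexive (U.sym x y)) (ab≤ y∈ x∈)
      go (inj₂ x∈) (inj₂ y∈) = b≤ x∈ y∈

    disjoint : ∀ {x} → x ∈ leafList a → x ∉ leafList b ++ concatMap leafList F
    disjoint = proj₂ (proj₂ (unique-++⁻ (leafList a) (↭allFin⇒unique cover)))

    crosses-ab : ∀ {x y} → x ∈ leafList a → y ∈ leafList b → ¬ SameTree (a ∷ b ∷ F) x y
    crosses-ab x∈a y∈b (here (_ , y∈a))         = disjoint y∈a (∈-++⁺ˡ y∈b)
    crosses-ab x∈a y∈b (there (here (x∈b , _))) = disjoint x∈a (∈-++⁺ˡ x∈b)
    crosses-ab x∈a y∈b (there (there same))     =
      disjoint x∈a (∈-++⁺ʳ (leafList b) (∈-concatMap⁺ leafList (Any.map proj₁ same)))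

    isMerge : IsMerge a b
    isMerge = record
      { p∈a = p∈a ; q∈b = q∈b ; p~q = p~q
      ; spread = spread
      ; gap = λ x∈ y∈ e → isLeast e (crosses-ab x∈ y∈)
      }

  locate : ∀ {F} → Invariant F → ∀ x → ∃ λ t → t ∈ F × x ∈ leafList t
  locate inv x = find (∈-concatMap⁻ leafList
    (∈-resp-↭ (↭-sym (Invariant.cover inv)) (∈-allFin x)))

  least-↭ : ∀ {F F′} → F ↭ F′ → LeastCrossing F → LeastCrossing F′
  least-↭ r ℓ = record
    { p~q = p~q
    ; crosses = crosses ∘ Any-resp-↭ (↭-sym r)
    ; isLeast = λ e c → isLeast e (c ∘ Any-resp-↭ r)
    }
    where open LeastCrossing ℓ

  -- One round of single linkage lowers the number of trees by one.
  step : ∀ {a b F} → Invariant (a ∷ b ∷ F) → ∃ λ F′ → length F′ ≡ suc (length F) × Invariant F′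
  step {a} {b} {F} inv = join (locate inv p)
    where
    ℓ = leastCrossing inv
    open LeastCrossing ℓ

    Result : Set
    Result = ∃ λ F′ → length F′ ≡ suc (length F) × Invariant F′

    join : (∃ λ s → s ∈ a ∷ b ∷ F × p ∈ leafList s) → Result
    join (s , s∈ , p∈s) = joinWith (locate (invariant-↭ r₁ inv) q)
      where
      F₁ = proj₁ (∈-select s∈)
      r₁ = proj₂ (∈-select s∈)
      joinWith : (∃ λ t → t ∈ s ∷ F₁ × q ∈ leafList t) → Result
      joinWith (_ , here refl , q∈s) =
        contradiction (Any-resp-↭ (↭-sym r₁) (here (p∈s , q∈s))) crosses
      joinWith (t , there t∈F₁ , q∈t) =
        let (F₂ , r₂) = ∈-select t∈F₁
            r = ↭-trans r₁ (prep s r₂)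
        in node s tt t ∷ F₂
         , ℕ.suc-injective (sym (↭-length r))
         , merge (invariant-↭ r inv) (least-↭ r ℓ) p∈s q∈t

  linkAll : ∀ k {F} → length F ≡ suc k → Invariant F → ∃ λ t → Invariant (t ∷ [])
  linkAll zero    {t ∷ []}    _  inv = t , inv
  linkAll (suc k) {a ∷ b ∷ F} eq inv =
    let (_ , eq′ , inv′) = step inv
    in linkAll k (trans eq′ (ℕ.suc-injective eq)) inv′

  -- Starting from n singletons, n - 1 rounds leave a single tree, whose leaves
  -- are all the vertices.
  linkedHierarchy : 1 ℕ.≤ n → ∃ λ (H : Hierarchy n) → Linked (Hierarchy.tree H)
  linkedHierarchy 1≤n =
    let (t , inv) = linkAll (ℕ.pred n)
          (trans (length-map leaf (allFin n))
            (trans (length-tabulate id) (sym (ℕ.suc-pred n {{ℕ.>-nonZero 1≤n}}))))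
          singletons-invariant
        open Invariant inv
    in record { tree = t ; leaves = subst (_↭ allFin n) (++-identityʳ (leafList t)) cover }
     , All.head linked

-- Comparison of the two objectives

-- The n ^ 4 comparisons of distances commute with double negation because the
-- index sets are finite.
¬¬-total : ∀ {n} (u : Fin n → Fin n → ℝ) →
           ¬ ¬ (∀ p q r s → u p q ≤ℝ u r s ⊎ u r s ≤ℝ u p q)
¬¬-total u = seqFin λ p → seqFin λ q → seqFin λ r → seqFin λ s → ≤ℝ-¬¬total (u p q) (u r s)
  where
  seqFin : ∀ {n} {P : Fin n → Set} → (∀ i → ¬ ¬ P i) → ¬ ¬ (∀ i → P i)
  seqFin = Fin.sequence (RawMonad.rawApplicative ¬¬-Monad)

weights-nonneg : ∀ {n} (G : ConnectedWeightedGraph n) →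
  All (λ (x , y) → ConnectedWeightedGraph.Adj G x y ×
                   EventuallyNonneg (ConnectedWeightedGraph.w G x y)) (edges G)
weights-nonneg G = All.tabulate λ {(x , y)} xy∈ →
  let (_ , _ , x~y) = ∈-filter⁻ edge? {xs = pairs G} xy∈
  in x~y , 0<ℝ⇒eventuallyNonneg {w x y} (w-pos x~y)
  where
  open ConnectedWeightedGraph G
  edge? : Unary.Decidable (λ (x , y) → x Fin.< y × Adj x y)
  edge? (x , y) = x Fin.<? y ×-dec adj? x y

corollary21 : (n : ℕ) → 2 ≤ n → (G : ConnectedWeightedGraph n) →
    (Γ : ℚ) → IsΓ G Γ →
    (optFree : ℝ) → IsOPT-free G optFree →
    (optCard : ℝ) → IsOPT-card G optCard →
    optCard ≤ℝ fromℚ Γ *ℝ optFree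
corollary21 n 2≤n G Γ isΓ optFree ((s , cost≈opt) , _) optCard (_ , opt≤) =
  ≤ℝ-stable (¬¬-map bound (¬¬-total u))
  where
  open ConnectedWeightedGraph G
  open FreeSolution s
  open SingleLinkage G u ultrametric dominates

  -- The claim, once all values of u can be compared.
  bound : (∀ p q r s → u p q ≤ℝ u r s ⊎ u r s ≤ℝ u p q) → optCard ≤ℝ fromℚ Γ *ℝ optFree
  bound total =
    let (H , linked) = linkedHierarchy G u ultrametric dominates total (ℕ.<⇒≤ 2≤n)
    in ≤ℝ.trans
         (opt≤ record { H = H ; dominates = linked-dominates H linked })
         (≤ℝ.trans
           (weightedSum-≤ Γ (λ (x , y) → w x y)
             (λ (x , y) → fromℕ (h H x y)) (λ (x , y) → u x y)
             (All.map (λ (x~y , w≥0) → w≥0 , linked-h≤ H linked isΓ x~y) (weights-nonneg G)))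
           (*ℝ-monoʳ-≤ (fromℚ Γ) (Γ-nonneg G isΓ) (≤ℝ.reflexive cost≈opt)))
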